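{- Let $n\ge 1$. For a $231$-avoiding permutation $\sigma\in\mathcal{S}_n(231)$ write $\operatorname{Des}(\sigma)=\{i_1<\dots<i_k\}$ and $\operatorname{iDes}(\sigma)=\{i'_1<\dots<i'_k\}$, and set $i_{k+1}:=n$, $i'_{k+1}:=n$. Let $\Phi(\sigma)$ be the $0/1$-word consisting of $i'_1$ letters $0$, followed by $i_1$ letters $1$, followed by $i'_2-i'_1$ letters $0$, followed by $i_2-i_1$ letters $1$, followed by $i'_3-i'_2$ letters $0$, and so on, ending with $i'_{k+1}-i'_k$ letters $0$ followed by $i_{k+1}-i_k$ letters $1$. Then $\Phi$ is a well-defined map from $\mathcal{S}_n(231)$ to $\mathcal{D}_n$ (that is, $\operatorname{Des}(\sigma)$ and $\operatorname{iDes}(\sigma)$ have the same cardinality and the resulting word is a Dyck path of semilength $n$), and $\Phi:\mathcal{S}_n(231)\to\mathcal{D}_n$ is a bijection.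
   Context: $\mathcal{S}_n$ is the symmetric group on $[n]=\{1,\dots,n\}$, with permutations written $\sigma=[\sigma_1,\dots,\sigma_n]$. A permutation is $231$-avoiding if there are no $i<j<k$ with $\sigma_k<\sigma_i<\sigma_j$; $\mathcal{S}_n(231)$ is the set of $231$-avoiding permutations in $\mathcal{S}_n$. The descent set is $\operatorname{Des}(\sigma)=\{i : 1\le i<n,\ \sigma_i>\sigma_{i+1}\}$, and $\operatorname{iDes}(\sigma):=\operatorname{Des}(\sigma^{ -1})$. A Dyck path of semilength $n$ is a word of length $2n$ with $n$ letters $0$ and $n$ letters $1$ such that every prefix contains at least as many $0$'s as $1$'s; $\mathcal{D}_n$ is the set of these. When $k=0$ the word $\Phi(\sigma)$ is $0^n1^n$. -}

module Defs where

open import Data.Fin using (Fin; toℕ; _<_)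
open import Data.Fin.Patterns using (0F; 1F)
import Data.Fin.Properties as Fin
open import Data.Fin.Permutation using (Permutation′; _⟨$⟩ʳ_; flip; _≈_)
open import Data.List using (List; []; _∷_; _++_; _∷ʳ_; concat; filter; length; replicate; upTo; zipWith)
open import Data.List.Relation.Binary.Prefix.Heterogeneous using (Prefix)
open import Data.Nat using (ℕ; suc; _∸_; _*_; _≤_)
import Data.Nat.Properties as ℕ
open import Data.Product using (Σ-syntax; ∃₂; _×_; _,_; proj₁; proj₂)
open import Function using (_on_)
open import Relation.Binary using (Rel)
open import Relation.Binary.PropositionalEquality using (_≡_)
open import Relation.Nullary using (¬_)
open import Relation.Nullary.Decidable using (_×-dec_)
open import Relation.Unary using (Decidable)
open import Level using (0ℓ)

-- The positions and values 1, …, n of a permutation are represented by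
-- the elements of Fin n, so that p : Fin n stands for suc (toℕ p).

Avoids231 : ∀ {n} → Permutation′ n → Set
Avoids231 σ = ∀ {i j k} → i < j → j < k →
  ¬ (σ ⟨$⟩ʳ k < σ ⟨$⟩ʳ i × σ ⟨$⟩ʳ i < σ ⟨$⟩ʳ j)

S231 : ℕ → Set
S231 n = Σ[ σ ∈ Permutation′ n ] Avoids231 σ

-- A Permutation′ carries proofs, so equality of permutations is
-- pointwise equality of the underlying functions.

_≈S_ : ∀ {n} → Rel (S231 n) 0ℓ
_≈S_ = _≈_ on proj₁

-- IsDescent σ i means 1 ≤ i < n and σᵢ > σᵢ₊₁, with i counted from 1:
-- p and q are the i-th and (i+1)-st positions, whose existence in Fin n
-- amounts to the bounds on i.

IsDescent : ∀ {n} → Permutation′ n → ℕ → Set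
IsDescent σ i =
  ∃₂ λ p q → suc (toℕ p) ≡ i × toℕ q ≡ i × σ ⟨$⟩ʳ q < σ ⟨$⟩ʳ p

isDescent? : ∀ {n} (σ : Permutation′ n) → Decidable (IsDescent σ)
isDescent? σ i = Fin.any? λ p → Fin.any? λ q →
  (suc (toℕ p) ℕ.≟ i) ×-dec (toℕ q ℕ.≟ i) ×-dec (σ ⟨$⟩ʳ q Fin.<? σ ⟨$⟩ʳ p)

-- Descent sets are listed in increasing order, without repetition.

Des : ∀ {n} → Permutation′ n → List ℕ
Des {n} σ = filter (isDescent? σ) (upTo n)

iDes : ∀ {n} → Permutation′ n → List ℕ
iDes σ = Des (flip σ)

Word : Set
Word = List (Fin 2)

count : Fin 2 → Word → ℕ
count a w = length (filter (a Fin.≟_) w)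

record IsDyckPath (n : ℕ) (w : Word) : Set where
  field
    length≡2n : length w ≡ 2 * n
    zeros     : count 0F w ≡ n
    ones      : count 1F w ≡ n
    prefixes  : ∀ {u} → Prefix _≡_ u w → count 1F u ≤ count 0F u

Dyck : ℕ → Set
Dyck n = Σ[ w ∈ Word ] IsDyckPath n w

_≈D_ : ∀ {n} → Rel (Dyck n) 0ℓ
_≈D_ = _≡_ on proj₁

-- differences a (x₁ ∷ x₂ ∷ …) = (x₁ - a) ∷ (x₂ - x₁) ∷ …; it is applied
-- below only to increasing lists, so ∸ is genuine subtraction.

differences : ℕ → List ℕ → List ℕ
differences a []       = []
differences a (x ∷ xs) = (x ∸ a) ∷ differences x xs

-- zipWith would drop blocks if the two lists had different lengths;
-- WellDefined below includes the equality of the lengths.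

Φ : ∀ {n} → Permutation′ n → Word
Φ {n} σ = concat (zipWith (λ a b → replicate a 0F ++ replicate b 1F)
  (differences 0 (iDes σ ∷ʳ n))
  (differences 0 (Des σ ∷ʳ n)))

WellDefined : ℕ → Set
WellDefined n = (σ : Permutation′ n) → Avoids231 σ →
  length (Des σ) ≡ length (iDes σ) × IsDyckPath n (Φ σ)

Φ-map : ∀ {n} → WellDefined n → S231 n → Dyck n
Φ-map wd (σ , av) = Φ σ , proj₂ (wd σ av)

{-# OPTIONS --safe #-}
module Submission where

-- Encode σ in S_{n+1} by two lists of n bits: the i-th bit of D-bits σ says
-- whether i is a descent of σ, and I-bits σ does the same for the inverse.
-- The word Φ σ is read off from these lists alternately: each inverse bit
-- gives a 0 and each descent bit a 1, and a true bit means "change over to the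
-- other list" (the relation Zeros).  A last 0 and a last 1 stand for the end
-- points i'_{k+1} = i_{k+1} = n+1.
--
-- Delete the value 1 from a 231-avoiding σ, say at position p, to get σ′, and
-- let z be the position of the value 1 in σ′; here positions are counted from 0.
-- Since σ avoids 231, it decreases up to p, and in the same way σ′ decreases up
-- to z.  Conversely, inserting a
-- new smallest value at position p into a 231-avoiding σ′ creates no 231 exactly
-- when p ≤ z + 1 (avoids⇒site, extend-avoids).  On the bit lists the effect is
-- simple (bits-step):
--   * if p = z + 1, both lists get a true bit in front;
--   * if p ≤ z, the inverse list gets a false bit in front, and the descent list
--     1^p K becomes 1^p 0 K.
-- Call a pair of lists Admissible if it arises from two empty lists by such
-- steps.  A step can be undone in one way only (step-injective), and p is the
-- number of leading true bits of D-bits σ, so 231-avoiding permutations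
-- correspond to admissible pairs (avoids⇒admissible, admissible⇒avoids,
-- bits-injective).
--
-- On words, the first kind of step puts 01 in front of a word, and the second
-- puts a 0 in front and inserts a 1 further on; both preserve Dyck paths
-- (admissible⇒ballot).  Conversely a Dyck path of semilength at least 2 begins
-- with 01 or with 00; in the second case delete the first 0 together with the
-- first 1 that is followed by another 1 (removeOne).  Every earlier run of 1s
-- has length 1, so the path does not fall below the axis, and the deleted 1 is a false
-- bit preceded by true bits only, as InsertFalse demands.  This gives
-- ballot⇒admissible.

open import Defs
open import Data.Nat using (ℕ; _≥_)
open import Data.Product using (Σ-syntax)
open import Function.Structures using (IsBijection)

open import Data.Bool using (Bool; true; false)
open import Data.Empty using (⊥; ⊥-elim)
open import Data.Fin using (Fin; zero; suc; toℕ; punchIn; punchOut; inject₁)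
open import Data.Fin.Patterns using (0F; 1F)
import Data.Fin.Properties as Fin
open import Data.Fin.Permutation
  using (Permutation′; _⟨$⟩ʳ_; _⟨$⟩ˡ_; flip; _≈_; inverseˡ; inverseʳ; remove; insert; id;
         punchIn-permute; insert-punchIn)
open import Data.List
  using (List; []; _∷_; _++_; _∷ʳ_; concat; filter; length; replicate; applyUpTo; zipWith)
open import Data.List.Properties using (++-assoc; filter-accept; filter-reject)
open import Data.List.Relation.Binary.Prefix.Heterogeneous using (Prefix; []; _∷_)
open import Data.Nat using (zero; suc; _+_; _*_; _≤_; _<_; _<?_; z≤n; s≤s; s≤s⁻¹)
import Data.Nat.Properties as ℕ
open import Data.Product using (_×_; _,_; proj₁; proj₂)
open import Data.Unit using (⊤; tt)
open import Function using (_∘_)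
open import Relation.Binary.Definitions using (tri<; tri≈; tri>)
open import Relation.Binary.PropositionalEquality
  using (_≡_; _≢_; _≗_; refl; sym; trans; cong; cong₂; subst; subst₂; module ≡-Reasoning)
open import Relation.Nullary using (Dec; yes; no; does; contradiction)
open import Relation.Nullary.Decidable using (dec-true; dec-false)
import Relation.Unary as U

-- Admissible pairs of bit lists

-- InsertFalse k E F: E begins with k true bits, and F is E with a false bit
-- inserted right after them.
data InsertFalse : ℕ → List Bool → List Bool → Set where
  here  : ∀ {E} → InsertFalse zero E (false ∷ E)
  there : ∀ {k E F} → InsertFalse k E F → InsertFalse (suc k) (true ∷ E) (true ∷ F)

insertFalse-functional : ∀ {k E F G} → InsertFalse k E F → InsertFalse k E G → F ≡ G
insertFalse-functional here      here      = refl
insertFalse-functional (there i) (there j) = cong (true ∷_) (insertFalse-functional i j)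

insertFalse-injective : ∀ {k l E F G} → InsertFalse k E G → InsertFalse l F G → E ≡ F
insertFalse-injective here      here      = refl
insertFalse-injective (there i) (there j) = cong (true ∷_) (insertFalse-injective i j)

-- The effect of inserting a new smallest value on the pair (inverse descents I,
-- descents D) of a 231-avoiding permutation.
data Step (I D : List Bool) : List Bool → List Bool → Set where
  both : Step I D (true ∷ I) (true ∷ D)
  pad  : ∀ {k D⁺} → InsertFalse k D D⁺ → Step I D (false ∷ I) D⁺

step-injective : ∀ {I D I′ D′ J E} → Step I D J E → Step I′ D′ J E → I ≡ I′ × D ≡ D′
step-injective both    both    = refl , refl
step-injective (pad i) (pad j) = refl , insertFalse-injective i j

-- The pairs of lists of n bits obtained from empty lists by n steps.
data Admissible : ℕ → List Bool → List Bool → Set where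
  base : Admissible zero [] []
  step : ∀ {n I D I⁺ D⁺} → Admissible n I D → Step I D I⁺ D⁺ → Admissible (suc n) I⁺ D⁺

-- The word read off from two bit lists

-- Zeros I D w: reading starts in I, and I, D are the bits still unread.  An
-- element of I gives a 0; when it is true, reading changes over to D (turn),
-- and symmetrically in Ones, where an element of D gives a 1.  When I is used up
-- there is one more 0, then the remaining bits of D, which have to be false, and
-- one more 1 (Tail).  So Zeros I D w also says that I and D contain equally many
-- true bits.
mutual
  data Zeros : List Bool → List Bool → Word → Set where
    last : ∀ {D w} → Tail D w → Zeros [] D (0F ∷ w)
    stay : ∀ {I D w} → Zeros I D w → Zeros (false ∷ I) D (0F ∷ w)
    turn : ∀ {I D w} → Ones I D w → Zeros (true ∷ I) D (0F ∷ w)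

  data Ones : List Bool → List Bool → Word → Set where
    stay : ∀ {I D w} → Ones I D w → Ones I (false ∷ D) (1F ∷ w)
    turn : ∀ {I D w} → Zeros I D w → Ones I (true ∷ D) (1F ∷ w)

  data Tail : List Bool → Word → Set where
    last : Tail [] (1F ∷ [])
    stay : ∀ {D w} → Tail D w → Tail (false ∷ D) (1F ∷ w)

-- Ones eventually turns, so a word read by it contains a 0, whereas Tail yields
-- only 1s.
tail≢ones : ∀ {I D E w} → Tail D w → Ones I E w → ⊥
tail≢ones last     (stay ())
tail≢ones last     (turn ())
tail≢ones (stay t) (stay o)  = tail≢ones t o
tail≢ones (stay ()) (turn (last _))
tail≢ones (stay ()) (turn (stay _))
tail≢ones (stay ()) (turn (turn _))

zeros≢ones : ∀ {I J D E w} → Zeros I D w → Ones J E w → ⊥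
zeros≢ones (last _) ()
zeros≢ones (stay _) ()
zeros≢ones (turn _) ()

zeros≢tail : ∀ {I D E w} → Zeros I D w → Tail E w → ⊥
zeros≢tail (last _) ()
zeros≢tail (stay _) ()
zeros≢tail (turn _) ()

tail-injective : ∀ {D E w} → Tail D w → Tail E w → D ≡ E
tail-injective last      last     = refl
tail-injective last      (stay ())
tail-injective (stay ()) last
tail-injective (stay t)  (stay u) = cong (false ∷_) (tail-injective t u)

-- The word determines the bit lists.
mutual
  zeros-injective : ∀ {I J D E w} → Zeros I D w → Zeros J E w → I ≡ J × D ≡ E
  zeros-injective (last t) (last u) = refl , tail-injective t u
  zeros-injective (last t) (stay z) = ⊥-elim (zeros≢tail z t)
  zeros-injective (last t) (turn o) = ⊥-elim (tail≢ones t o)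
  zeros-injective (stay z) (last t) = ⊥-elim (zeros≢tail z t)
  zeros-injective (stay y) (stay z) with refl , refl ← zeros-injective y z = refl , refl
  zeros-injective (stay z) (turn o) = ⊥-elim (zeros≢ones z o)
  zeros-injective (turn o) (last t) = ⊥-elim (tail≢ones t o)
  zeros-injective (turn o) (stay z) = ⊥-elim (zeros≢ones z o)
  zeros-injective (turn o) (turn p) with refl , refl ← ones-injective o p = refl , refl

  ones-injective : ∀ {I J D E w} → Ones I D w → Ones J E w → I ≡ J × D ≡ E
  ones-injective (stay o) (stay p) with refl , refl ← ones-injective o p = refl , refl
  ones-injective (stay o) (turn z) = ⊥-elim (zeros≢ones z o)
  ones-injective (turn z) (stay o) = ⊥-elim (zeros≢ones z o)
  ones-injective (turn y) (turn z) with refl , refl ← zeros-injective y z = refl , refl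

-- Dyck paths as ballot sequences

-- Ballot h n w: starting at height h, with 0 as up-step and 1 as down-step, the
-- word w stays at nonnegative height, ends at height 0 and has n up-steps.
data Ballot : ℕ → ℕ → Word → Set where
  []   : Ballot zero zero []
  up   : ∀ {h n w} → Ballot (suc h) n w → Ballot h (suc n) (0F ∷ w)
  down : ∀ {h n w} → Ballot h n w → Ballot (suc h) n (1F ∷ w)

ballot-zeros : ∀ {h n w} → Ballot h n w → count 0F w ≡ n
ballot-zeros []       = refl
ballot-zeros (up b)   = cong suc (ballot-zeros b)
ballot-zeros (down b) = ballot-zeros b

ballot-ones : ∀ {h n w} → Ballot h n w → count 1F w ≡ h + n
ballot-ones []                   = refl
ballot-ones (up {h} {n} b)       = trans (ballot-ones b) (sym (ℕ.+-suc h n))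
ballot-ones (down b)             = cong suc (ballot-ones b)

ballot-prefix : ∀ {h n u w} → Ballot h n w → Prefix _≡_ u w → count 1F u ≤ h + count 0F u
ballot-prefix b        []         = z≤n
ballot-prefix {h} {u = _ ∷ u} (up b) (refl ∷ p) =
  subst (count 1F u ≤_) (sym (ℕ.+-suc h (count 0F u))) (ballot-prefix b p)
ballot-prefix (down b) (refl ∷ p) = s≤s (ballot-prefix b p)

length-count : ∀ w → length w ≡ count 0F w + count 1F w
length-count []       = refl
length-count (0F ∷ w) = cong suc (length-count w)
length-count (1F ∷ w) = trans (cong suc (length-count w)) (sym (ℕ.+-suc _ _))

ballot⇒dyck : ∀ {n w} → Ballot 0 n w → IsDyckPath n w
ballot⇒dyck {n} {w} b = record
  { length≡2n = begin
      length w                 ≡⟨ length-count w ⟩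
      count 0F w + count 1F w  ≡⟨ cong₂ _+_ (ballot-zeros b) (ballot-ones b) ⟩
      n + n                    ≡⟨ cong (n +_) (sym (ℕ.+-identityʳ n)) ⟩
      2 * n                    ∎
  ; zeros     = ballot-zeros b
  ; ones      = ballot-ones b
  ; prefixes  = ballot-prefix b
  }
  where open ≡-Reasoning

prefixes⇒ballot : ∀ h w → count 1F w ≡ h + count 0F w →
  (∀ {u} → Prefix _≡_ u w → count 1F u ≤ h + count 0F u) → Ballot h (count 0F w) w
prefixes⇒ballot zero    []       eq ≤h = []
prefixes⇒ballot h       (0F ∷ w) eq ≤h = up (prefixes⇒ballot (suc h) w
  (trans eq (ℕ.+-suc h _))
  (λ {u} p → subst (count 1F u ≤_) (ℕ.+-suc h _) (≤h (refl ∷ p))))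
prefixes⇒ballot zero    (1F ∷ w) eq ≤h = contradiction (≤h (refl ∷ [])) λ ()
prefixes⇒ballot (suc h) (1F ∷ w) eq ≤h =
  down (prefixes⇒ballot h w (ℕ.suc-injective eq) (λ p → s≤s⁻¹ (≤h (refl ∷ p))))

dyck⇒ballot : ∀ {n w} → IsDyckPath n w → Ballot 0 n w
dyck⇒ballot {w = w} d =
  subst (λ n → Ballot 0 n w) zeros (prefixes⇒ballot 0 w (trans ones (sym zeros)) prefixes)
  where open IsDyckPath d

-- Admissible pairs correspond to Dyck paths

-- InsertOne v w: w is v with one letter 1 inserted somewhere.
data InsertOne : Word → Word → Set where
  here  : ∀ {w} → InsertOne w (1F ∷ w)
  there : ∀ {a v w} → InsertOne v w → InsertOne (a ∷ v) (a ∷ w)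

insertOne-ballot : ∀ {h n v w} → InsertOne v w → Ballot h n v → Ballot (suc h) n w
insertOne-ballot here      b        = down b
insertOne-ballot (there i) (up b)   = up (insertOne-ballot i b)
insertOne-ballot (there i) (down b) = down (insertOne-ballot i b)

-- A false bit inserted in the descent list only lengthens a run of 1s.
mutual
  insertFalse-zeros : ∀ {k I D D⁺ w} → InsertFalse k D D⁺ → Zeros I D w →
    Σ[ w⁺ ∈ Word ] Zeros I D⁺ w⁺ × InsertOne w w⁺
  insertFalse-zeros here (last t)      = _ , last (stay t) , there here
  insertFalse-zeros (there i) (last ())
  insertFalse-zeros i (stay z) with _ , z⁺ , j ← insertFalse-zeros i z = _ , stay z⁺ , there j
  insertFalse-zeros i (turn o) with _ , o⁺ , j ← insertFalse-ones i o = _ , turn o⁺ , there j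

  insertFalse-ones : ∀ {k I D D⁺ w} → InsertFalse k D D⁺ → Ones I D w →
    Σ[ w⁺ ∈ Word ] Ones I D⁺ w⁺ × InsertOne w w⁺
  insertFalse-ones here      o        = _ , stay o , here
  insertFalse-ones (there i) (turn z) with _ , z⁺ , j ← insertFalse-zeros i z
    = _ , turn z⁺ , there j

admissible⇒ballot : ∀ {n I D} → Admissible n I D → Σ[ w ∈ Word ] Zeros I D w × Ballot 0 (suc n) w
admissible⇒ballot base = _ , last last , up (down [])
admissible⇒ballot (step a both)
  with _ , z , b ← admissible⇒ballot a = _ , turn (turn z) , up (down b)
admissible⇒ballot (step a (pad i))
  with _ , z , b ← admissible⇒ballot a
  with _ , z⁺ , j ← insertFalse-zeros i z = _ , stay z⁺ , up (insertOne-ballot j b)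

-- Deletes the first 1 that is followed by another 1.  Such a 1 exists because
-- the walk starts with 0 at positive height and ends at height 0.  The last
-- component says that the deletion undoes an insertion of a false bit after
-- leading true bits, whatever lists the shortened word is read from.
removeOne : ∀ {h n w} → Ballot (suc h) n (0F ∷ w) →
  Σ[ v ∈ Word ] Ballot h n (0F ∷ v) ×
    (∀ {I D} → Zeros I D (0F ∷ v) →
      Σ[ k ∈ ℕ ] Σ[ D⁺ ∈ List Bool ] InsertFalse k D D⁺ × Zeros I D⁺ (0F ∷ w))
removeOne (up b@(up _)) with v , c , lift ← removeOne b = 0F ∷ v , up c , λ where
  (stay z) → let k , _ , i , z⁺ = lift z in k , _ , i , stay z⁺
  (last ())
  (turn ())
removeOne (up (down b@(up _))) with v , c , lift ← removeOne b = 1F ∷ 0F ∷ v , up (down c) , λ where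
  (turn (turn z)) → let k , _ , i , z⁺ = lift z in suc k , _ , there i , turn (turn z⁺)
  (last (stay ()))
  (stay ())
  (turn (stay ()))
removeOne (up (down (down b))) = _ , up (down b) , λ where
  (last t) → _ , _ , here , last (stay t)
  (stay ())
  (turn o) → _ , _ , here , turn (stay o)

ballot⇒admissible : ∀ {n w} → Ballot 0 (suc n) w →
  Σ[ I ∈ List Bool ] Σ[ D ∈ List Bool ] Admissible n I D × Zeros I D w
ballot⇒admissible {zero}  (up (down [])) = _ , _ , base , last last
ballot⇒admissible {suc n} (up (down b))
  with _ , _ , a , z ← ballot⇒admissible b = _ , _ , step a both , turn (turn z)
ballot⇒admissible {suc n} (up b@(up _))
  with _ , c , lift ← removeOne b
  with _ , _ , a , z ← ballot⇒admissible c
  with _ , _ , i , z⁺ ← lift z = _ , _ , step a (pad i) , stay z⁺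

-- Φ in terms of bit lists

-- positions a bs lists the places of the true bits of bs, counted from a.
positions : ℕ → List Bool → List ℕ
positions a []           = []
positions a (true  ∷ bs) = a ∷ positions (suc a) bs
positions a (false ∷ bs) = positions (suc a) bs

-- The lengths of the blocks into which the true bits cut the list, each true
-- bit closing its block; c bits of the first block have been read already, and
-- the last block is closed by an additional bit after the end.
gaps : ℕ → List Bool → List ℕ
gaps c []           = suc c ∷ []
gaps c (true  ∷ bs) = suc c ∷ gaps 0 bs
gaps c (false ∷ bs) = gaps (suc c) bs

-- The current position is a + c + 1, where a is the position of the previous
-- true bit.
differences-positions : ∀ c a bs →
  differences a (positions (suc (c + a)) bs ∷ʳ suc (length bs + (c + a))) ≡ gaps c bs
differences-positions c a []           = cong (_∷ []) (ℕ.m+n∸n≡m (suc c) a)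
differences-positions c a (true  ∷ bs) = cong₂ _∷_ (ℕ.m+n∸n≡m (suc c) a) (trans
  (cong (λ m → differences (suc (c + a)) (positions (suc (suc (c + a))) bs ∷ʳ suc m))
    (sym (ℕ.+-suc (length bs) (c + a))))
  (differences-positions 0 (suc (c + a)) bs))
differences-positions c a (false ∷ bs) = trans
  (cong (λ m → differences a (positions (suc (suc (c + a))) bs ∷ʳ suc m))
    (sym (ℕ.+-suc (length bs) (c + a))))
  (differences-positions (suc c) a bs)

-- The word in which runs of 0s of lengths as alternate with runs of 1s of
-- lengths bs.
blocks : List ℕ → List ℕ → Word
blocks as bs = concat (zipWith (λ a b → replicate a 0F ++ replicate b 1F) as bs)

replicate-shift : ∀ {A : Set} c (x : A) xs → replicate c x ++ x ∷ xs ≡ replicate (suc c) x ++ xs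
replicate-shift zero    x xs = refl
replicate-shift (suc c) x xs = cong (x ∷_) (replicate-shift c x xs)

blocks-tail : ∀ {D w} k e → Tail D w →
  blocks (k ∷ []) (gaps e D) ≡ replicate k 0F ++ replicate e 1F ++ w
blocks-tail k e last = begin
  (replicate k 0F ++ replicate (suc e) 1F) ++ []  ≡⟨ ++-assoc (replicate k 0F) _ _ ⟩
  replicate k 0F ++ replicate (suc e) 1F ++ []
    ≡⟨ cong (replicate k 0F ++_) (sym (replicate-shift e 1F [])) ⟩
  replicate k 0F ++ replicate e 1F ++ 1F ∷ []     ∎
  where open ≡-Reasoning
blocks-tail k e (stay t) = trans (blocks-tail k (suc e) t)
  (cong (replicate k 0F ++_) (sym (replicate-shift e 1F _)))

-- c and e count the letters read so far in an unfinished run of 0s and of 1s, and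
-- k is the length of the last finished run of 0s.
mutual
  blocks-zeros : ∀ {I D w} c → Zeros I D w → blocks (gaps c I) (gaps 0 D) ≡ replicate c 0F ++ w
  blocks-zeros c (last t) = trans (blocks-tail (suc c) 0 t) (sym (replicate-shift c 0F _))
  blocks-zeros c (stay z) = trans (blocks-zeros (suc c) z) (sym (replicate-shift c 0F _))
  blocks-zeros c (turn o) = trans (blocks-ones (suc c) 0 o) (sym (replicate-shift c 0F _))

  blocks-ones : ∀ {I D w} k e → Ones I D w →
    blocks (k ∷ gaps 0 I) (gaps e D) ≡ replicate k 0F ++ replicate e 1F ++ w
  blocks-ones k e (stay o) = trans (blocks-ones k (suc e) o)
    (cong (replicate k 0F ++_) (sym (replicate-shift e 1F _)))
  blocks-ones {I} k e (turn {D = D} {w} z) = begin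
    (replicate k 0F ++ replicate (suc e) 1F) ++ blocks (gaps 0 I) (gaps 0 D)
      ≡⟨ cong (_ ++_) (blocks-zeros 0 z) ⟩
    (replicate k 0F ++ replicate (suc e) 1F) ++ w  ≡⟨ ++-assoc (replicate k 0F) _ _ ⟩
    replicate k 0F ++ replicate (suc e) 1F ++ w
      ≡⟨ cong (replicate k 0F ++_) (sym (replicate-shift e 1F w)) ⟩
    replicate k 0F ++ replicate e 1F ++ 1F ∷ w     ∎
    where open ≡-Reasoning

mutual
  zeros-balanced : ∀ {I D w} → Zeros I D w → ∀ a b → length (positions a I) ≡ length (positions b D)
  zeros-balanced (last t) a b = tail-empty t b
  zeros-balanced (stay z) a b = zeros-balanced z (suc a) b
  zeros-balanced (turn o) a b = ones-balanced o (suc a) b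

  ones-balanced : ∀ {I D w} → Ones I D w → ∀ a b →
    suc (length (positions a I)) ≡ length (positions b D)
  ones-balanced (stay o) a b = ones-balanced o a (suc b)
  ones-balanced (turn z) a b = cong suc (zeros-balanced z a (suc b))

  tail-empty : ∀ {D w} → Tail D w → ∀ b → 0 ≡ length (positions b D)
  tail-empty last     b = refl
  tail-empty (stay t) b = tail-empty t (suc b)

-- The descent word of f: the i-th bit says whether the i-th value is greater
-- than the next one.
descents : ∀ {n} → (Fin (suc n) → ℕ) → List Bool
descents {zero}  f = []
descents {suc n} f = does (f 1F <? f 0F) ∷ descents (f ∘ suc)

length-descents : ∀ {n} (f : Fin (suc n) → ℕ) → length (descents f) ≡ n
length-descents {zero}  f = refl
length-descents {suc n} f = cong suc (length-descents (f ∘ suc))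

-- The enumeration s is m ↦ m + a, up to pointwise equality, so that it matches
-- the successive tails of applyUpTo.
filter-descents : ∀ {n} {P : ℕ → Set} (P? : U.Decidable P) (g : Fin (suc n) → ℕ) a (s : ℕ → ℕ) →
  (∀ m → s m ≡ m + a) →
  (∀ i → P (s (toℕ i)) → g (suc i) < g (inject₁ i)) →
  (∀ i → g (suc i) < g (inject₁ i) → P (s (toℕ i))) →
  filter P? (applyUpTo s n) ≡ positions a (descents g)
filter-descents {zero}  P? g a s s≡ to from = refl
filter-descents {suc n} P? g a s s≡ to from with g 1F <? g 0F
... | yes lt rewrite dec-true (g 1F <? g 0F) lt = trans (filter-accept P? (from 0F lt)) (cong₂ _∷_ (s≡ 0)
  (filter-descents P? (g ∘ suc) (suc a) (s ∘ suc) (λ m → trans (s≡ (suc m)) (sym (ℕ.+-suc m a)))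
    (to ∘ suc) (from ∘ suc)))
... | no ≮ rewrite dec-false (g 1F <? g 0F) ≮ = trans (filter-reject P? (≮ ∘ to 0F))
  (filter-descents P? (g ∘ suc) (suc a) (s ∘ suc) (λ m → trans (s≡ (suc m)) (sym (ℕ.+-suc m a)))
    (to ∘ suc) (from ∘ suc))

-- The descents and the inverse descents of a permutation as bits.
D-bits I-bits : ∀ {n} → Permutation′ (suc n) → List Bool
D-bits σ = descents (toℕ ∘ (σ ⟨$⟩ʳ_))
I-bits σ = D-bits (flip σ)

Des≡positions : ∀ {n} (σ : Permutation′ (suc n)) → Des σ ≡ positions 1 (D-bits σ)
Des≡positions {n} σ = trans (filter-reject (isDescent? σ) {x = 0} λ { (_ , _ , () , _) })
  (filter-descents (isDescent? σ) (toℕ ∘ (σ ⟨$⟩ʳ_)) 1 suc (λ m → sym (ℕ.+-comm m 1)) to from)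
  where
  to : ∀ i → IsDescent σ (suc (toℕ i)) → toℕ (σ ⟨$⟩ʳ suc i) < toℕ (σ ⟨$⟩ʳ inject₁ i)
  to i (p , q , p≡ , q≡ , q<p)
    with refl ← Fin.toℕ-injective {j = inject₁ i}
                  (trans (ℕ.suc-injective p≡) (sym (Fin.toℕ-inject₁ i)))
    with refl ← Fin.toℕ-injective {j = suc i} q≡ = q<p

  from : ∀ i → toℕ (σ ⟨$⟩ʳ suc i) < toℕ (σ ⟨$⟩ʳ inject₁ i) → IsDescent σ (suc (toℕ i))
  from i lt = inject₁ i , suc i , cong suc (Fin.toℕ-inject₁ i) , refl , lt

differences-Des : ∀ {n} (σ : Permutation′ (suc n)) → differences 0 (Des σ ∷ʳ suc n) ≡ gaps 0 (D-bits σ)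
differences-Des {n} σ = begin
  differences 0 (Des σ ∷ʳ suc n)
    ≡⟨ cong₂ (λ l m → differences 0 (l ∷ʳ suc m)) (Des≡positions σ)
         (sym (trans (ℕ.+-identityʳ _) (length-descents (toℕ ∘ (σ ⟨$⟩ʳ_))))) ⟩
  differences 0 (positions 1 (D-bits σ) ∷ʳ suc (length (D-bits σ) + 0))
    ≡⟨ differences-positions 0 0 (D-bits σ) ⟩
  gaps 0 (D-bits σ)  ∎
  where open ≡-Reasoning

Φ≡blocks : ∀ {n} (σ : Permutation′ (suc n)) → Φ σ ≡ blocks (gaps 0 (I-bits σ)) (gaps 0 (D-bits σ))
Φ≡blocks σ = cong₂ blocks (differences-Des (flip σ)) (differences-Des σ)

Φ-unique : ∀ {n} (σ : Permutation′ (suc n)) {w} → Zeros (I-bits σ) (D-bits σ) w → Φ σ ≡ w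
Φ-unique σ z = trans (Φ≡blocks σ) (blocks-zeros 0 z)

length-Des : ∀ {n} (σ : Permutation′ (suc n)) {w} →
  Zeros (I-bits σ) (D-bits σ) w → length (Des σ) ≡ length (iDes σ)
length-Des σ z = sym (begin
  length (iDes σ)                  ≡⟨ cong length (Des≡positions (flip σ)) ⟩
  length (positions 1 (I-bits σ))  ≡⟨ zeros-balanced z 1 1 ⟩
  length (positions 1 (D-bits σ))  ≡⟨ cong length (sym (Des≡positions σ)) ⟩
  length (Des σ)                   ∎)
  where open ≡-Reasoning

-- Descents of a function

does-cong : ∀ {A B : Set} (a? : Dec A) (b? : Dec B) → (A → B) → (B → A) → does a? ≡ does b?
does-cong a? (yes b) to from = dec-true a? (from b)
does-cong a? (no ¬b) to from = dec-false a? (¬b ∘ to)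

descents-cong : ∀ {n} (f g : Fin (suc n) → ℕ) →
  (∀ i j → f i < f j → g i < g j) → (∀ i j → g i < g j → f i < f j) → descents f ≡ descents g
descents-cong {zero}  f g to from = refl
descents-cong {suc n} f g to from = cong₂ _∷_
  (does-cong (f 1F <? f 0F) (g 1F <? g 0F) (to 1F 0F) (from 1F 0F))
  (descents-cong (f ∘ suc) (g ∘ suc) (λ i j → to (suc i) (suc j)) (λ i j → from (suc i) (suc j)))

descents-≗ : ∀ {n} {f g : Fin (suc n) → ℕ} → f ≗ g → descents f ≡ descents g
descents-≗ {f = f} {g} f≗g = descents-cong f g
  (λ i j → subst₂ _<_ (f≗g i) (f≗g j))
  (λ i j → subst₂ _<_ (sym (f≗g i)) (sym (f≗g j)))

-- f 0 > f 1 > ⋯ > f p, stated for neighbouring arguments.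
DecreasingTo : ∀ {n} → Fin (suc n) → (Fin (suc n) → ℕ) → Set
DecreasingTo         zero    f = ⊤
DecreasingTo {suc n} (suc p) f = f 1F < f 0F × DecreasingTo p (f ∘ suc)

decreasingTo : ∀ {n} p {f : Fin (suc n) → ℕ} →
  (∀ {i j} → toℕ i < toℕ j → toℕ j ≤ toℕ p → f j < f i) → DecreasingTo p f
decreasingTo         zero    dec = tt
decreasingTo {suc n} (suc p) dec =
  dec {0F} {1F} (s≤s z≤n) (s≤s z≤n) , decreasingTo p λ i<j j≤p → dec (s≤s i<j) (s≤s j≤p)

decreasing-before-min : ∀ {n} p z {f : Fin (suc n) → ℕ} →
  DecreasingTo p f → (∀ j → f z ≤ f j) → toℕ p ≤ toℕ z
decreasing-before-min         zero    z       d       min = z≤n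
decreasing-before-min {suc n} (suc p) zero    (lt , _) min = contradiction lt (ℕ.≤⇒≯ (min 1F))
decreasing-before-min {suc n} (suc p) (suc z) (_ , d) min =
  s≤s (decreasing-before-min p z d (min ∘ suc))

leadingTrues : List Bool → ℕ
leadingTrues []           = zero
leadingTrues (false ∷ bs) = zero
leadingTrues (true  ∷ bs) = suc (leadingTrues bs)

-- If f decreases up to its minimum at p, the initial decreasing run ends there.
leadingTrues-descents : ∀ {n} p {f : Fin (suc n) → ℕ} →
  DecreasingTo p f → (∀ j → f p ≤ f j) → leadingTrues (descents f) ≡ toℕ p
leadingTrues-descents {zero}  zero    d        min = refl
leadingTrues-descents {suc n} zero    {f} d    min
  rewrite dec-false (f 1F <? f 0F) (ℕ.≤⇒≯ (min 1F)) = refl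
leadingTrues-descents {suc n} (suc p) {f} (lt , d) min
  rewrite dec-true (f 1F <? f 0F) lt = cong suc (leadingTrues-descents p d (min ∘ suc))

-- f arises from g by inserting the value 0 at p and raising the other values by 1.
record InsertZero {n} (p : Fin (suc n)) (g : Fin n → ℕ) (f : Fin (suc n) → ℕ) : Set where
  field
    at-new : f p ≡ 0
    at-old : ∀ i → f (punchIn p i) ≡ suc (g i)
open InsertZero

insertZero-tail : ∀ {n p g f} → InsertZero {suc n} (suc p) g f → InsertZero p (g ∘ suc) (f ∘ suc)
insertZero-tail e = record { at-new = at-new e ; at-old = at-old e ∘ suc }

insert-before-descent : ∀ {n} (p : Fin (suc n)) {g f} → g 1F < g 0F →
  InsertZero (inject₁ (suc p)) g f → f 1F < f 0F
insert-before-descent         zero    lt e = subst₂ _<_ (sym (at-new e)) (sym (at-old e 0F)) (s≤s z≤n)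
insert-before-descent {suc n} (suc p) lt e = subst₂ _<_ (sym (at-old e 1F)) (sym (at-old e 0F)) (s≤s lt)

-- Inserting 0 within the initial decreasing run of g: the step into the new
-- entry is a descent and the step out of it an ascent.
descents-insert-before : ∀ {n} (p : Fin (suc n)) {g f} → DecreasingTo p g →
  InsertZero (inject₁ p) g f → InsertFalse (toℕ p) (descents g) (descents f)
descents-insert-before zero {g} {f} d e
  rewrite dec-false (f 1F <? f 0F) (λ lt → ℕ.n≮0 (subst (f 1F <_) (at-new e) lt))
        | descents-cong (f ∘ suc) g
            (λ i j lt → s≤s⁻¹ (subst₂ _<_ (at-old e i) (at-old e j) lt))
            (λ i j lt → subst₂ _<_ (sym (at-old e i)) (sym (at-old e j)) (s≤s lt)) = here
descents-insert-before {suc n} (suc p) {g} {f} (lt , d) e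
  rewrite dec-true (g 1F <? g 0F) lt
        | dec-true (f 1F <? f 0F) (insert-before-descent p lt e)
  = there (descents-insert-before p d (insertZero-tail e))

-- Inserting 0 immediately after the minimum z of g, where the initial decreasing
-- run ends: it prolongs the run by one.
descents-insert-after : ∀ {n} (z : Fin (suc n)) {g f} → DecreasingTo z g → (∀ j → g z ≤ g j) →
  InsertZero (suc z) g f → descents f ≡ true ∷ descents g
descents-insert-after {zero} zero {g} {f} d min e
  rewrite dec-true (f 1F <? f 0F) (subst₂ _<_ (sym (at-new e)) (sym (at-old e 0F)) (s≤s z≤n)) = refl
descents-insert-after {suc n} zero {g} {f} d min e
  rewrite dec-true (f 1F <? f 0F) (subst₂ _<_ (sym (at-new e)) (sym (at-old e 0F)) (s≤s z≤n))
        | dec-false (f (suc 1F) <? f 1F) (λ lt → ℕ.n≮0 (subst (f (suc 1F) <_) (at-new e) lt))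
        | dec-false (g 1F <? g 0F) (ℕ.≤⇒≯ (min 1F)) = cong (λ bs → true ∷ false ∷ bs)
  (descents-cong (λ i → f (suc (suc i))) (g ∘ suc)
    (λ i j lt → s≤s⁻¹ (subst₂ _<_ (at-old e (suc i)) (at-old e (suc j)) lt))
    (λ i j lt → subst₂ _<_ (sym (at-old e (suc i))) (sym (at-old e (suc j))) (s≤s lt)))
descents-insert-after {suc n} (suc z) {g} {f} (lt , d) min e
  rewrite dec-true (f 1F <? f 0F) (subst₂ _<_ (sym (at-old e 1F)) (sym (at-old e 0F)) (s≤s lt))
        | dec-true (g 1F <? g 0F) lt
  = cong (true ∷_) (descents-insert-after z d (min ∘ suc) (insertZero-tail e))

-- The leading true bits of descents g are an initial decreasing run of g.
decreasing-from-insertFalse : ∀ {n k D⁺} (g : Fin (suc n) → ℕ) → InsertFalse k (descents g) D⁺ →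
  Σ[ p ∈ Fin (suc n) ] toℕ p ≡ k × DecreasingTo p g
decreasing-from-insertFalse {zero}  g here = zero , refl , tt
decreasing-from-insertFalse {suc n} g i with g 1F <? g 0F
... | no ≮ rewrite dec-false (g 1F <? g 0F) ≮ with here ← i = zero , refl , tt
... | yes lt rewrite dec-true (g 1F <? g 0F) lt with i
...   | here    = zero , refl , tt
...   | there j with p , refl , d ← decreasing-from-insertFalse (g ∘ suc) j = suc p , refl , lt , d

-- Inserting and removing the smallest value

punchIn-below : ∀ {n} (p : Fin (suc n)) i → toℕ i < toℕ p → toℕ (punchIn p i) < toℕ p
punchIn-below (suc p) zero    i<p = s≤s z≤n
punchIn-below (suc p) (suc i) i<p = s≤s (punchIn-below p i (s≤s⁻¹ i<p))

punchIn-below⁻¹ : ∀ {n} (p : Fin (suc n)) i → toℕ (punchIn p i) < toℕ p → toℕ i < toℕ p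
punchIn-below⁻¹ (suc p) zero    i<p = s≤s z≤n
punchIn-below⁻¹ (suc p) (suc i) i<p = s≤s (punchIn-below⁻¹ p i (s≤s⁻¹ i<p))

punchIn-mono-< : ∀ {n} (p : Fin (suc n)) i j → toℕ i < toℕ j → toℕ (punchIn p i) < toℕ (punchIn p j)
punchIn-mono-< p i j i<j = ℕ.≰⇒> (ℕ.<⇒≱ i<j ∘ Fin.punchIn-cancel-≤ p j i)

punchIn-cancel-< : ∀ {n} (p : Fin (suc n)) i j → toℕ (punchIn p i) < toℕ (punchIn p j) → toℕ i < toℕ j
punchIn-cancel-< p i j lt = ℕ.≰⇒> (ℕ.<⇒≱ lt ∘ Fin.punchIn-mono-≤ p j i)

-- Every position is either the place p of insertion or an old position.
data PunchView {n} (p : Fin (suc n)) : Fin (suc n) → Set where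
  self  : PunchView p p
  other : ∀ i → PunchView p (punchIn p i)

punchView : ∀ {n} (p i : Fin (suc n)) → PunchView p i
punchView p i with p Fin.≟ i
... | yes refl = self
... | no p≢i = subst (PunchView p) (Fin.punchIn-punchOut p≢i) (other (punchOut p≢i))

-- σ arises from σ′ by inserting a new smallest value at position p.
record Extends {n} (p : Fin (suc n)) (σ′ : Permutation′ n) (σ : Permutation′ (suc n)) : Set where
  field
    new : σ ⟨$⟩ʳ p ≡ zero
    old : ∀ i → σ ⟨$⟩ʳ punchIn p i ≡ suc (σ′ ⟨$⟩ʳ i)

-- The position of the smallest value.
pos0 : ∀ {n} → Permutation′ (suc n) → Fin (suc n)
pos0 σ = σ ⟨$⟩ˡ zero

pos0-min : ∀ {n} (σ : Permutation′ (suc n)) j → toℕ (σ ⟨$⟩ʳ pos0 σ) ≤ toℕ (σ ⟨$⟩ʳ j)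
pos0-min σ j rewrite inverseʳ σ {zero} = z≤n

insert-extends : ∀ {n} p (σ′ : Permutation′ n) → Extends p σ′ (insert p zero σ′)
insert-extends p σ′ = record { new = new ; old = insert-punchIn p zero σ′ }
  where
  new : insert p zero σ′ ⟨$⟩ʳ p ≡ zero
  new with p Fin.≟ p
  ... | yes _  = refl
  ... | no p≢p = contradiction refl p≢p

remove-extends : ∀ {n} (σ : Permutation′ (suc n)) → Extends (pos0 σ) (remove (pos0 σ) σ) σ
remove-extends σ = record
  { new = inverseʳ σ
  ; old = λ i → trans (punchIn-permute σ (pos0 σ) i)
                  (cong (λ v → punchIn v (remove (pos0 σ) σ ⟨$⟩ʳ i)) (inverseʳ σ))
  }

module _ {n} {p : Fin (suc n)} {σ′ : Permutation′ n} {σ : Permutation′ (suc n)}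
         (ext : Extends p σ′ σ) where
  open Extends ext

  insertZero : InsertZero p (toℕ ∘ (σ′ ⟨$⟩ʳ_)) (toℕ ∘ (σ ⟨$⟩ʳ_))
  insertZero = record { at-new = cong toℕ new ; at-old = cong toℕ ∘ old }

  inverse-new : σ ⟨$⟩ˡ zero ≡ p
  inverse-new = trans (cong (σ ⟨$⟩ˡ_) (sym new)) (inverseˡ σ)

  inverse-old : ∀ v → σ ⟨$⟩ˡ suc v ≡ punchIn p (σ′ ⟨$⟩ˡ v)
  inverse-old v = trans
    (cong (σ ⟨$⟩ˡ_) (sym (trans (old (σ′ ⟨$⟩ˡ v)) (cong suc (inverseʳ σ′)))))
    (inverseˡ σ)

  old-mono : ∀ i j → toℕ (σ′ ⟨$⟩ʳ i) < toℕ (σ′ ⟨$⟩ʳ j) →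
    toℕ (σ ⟨$⟩ʳ punchIn p i) < toℕ (σ ⟨$⟩ʳ punchIn p j)
  old-mono i j lt rewrite old i | old j = s≤s lt

  old-cancel : ∀ i j → toℕ (σ ⟨$⟩ʳ punchIn p i) < toℕ (σ ⟨$⟩ʳ punchIn p j) →
    toℕ (σ′ ⟨$⟩ʳ i) < toℕ (σ′ ⟨$⟩ʳ j)
  old-cancel i j lt rewrite old i | old j = s≤s⁻¹ lt

  new≮ : ∀ {m} → m < toℕ (σ ⟨$⟩ʳ p) → ⊥
  new≮ {m} lt = ℕ.n≮0 (subst (λ v → m < toℕ v) new lt)

  restrict-avoids : Avoids231 σ → Avoids231 σ′
  restrict-avoids av {i} {j} {k} i<j j<k (k<i , i<j′) =
    av (punchIn-mono-< p i j i<j) (punchIn-mono-< p j k j<k) (old-mono k i k<i , old-mono i j i<j′)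

-- An ascent before the smallest value would form a 231 with it.
decreasing-to-zero : ∀ {n} (σ : Permutation′ (suc n)) → Avoids231 σ →
  ∀ {i j} → toℕ i < toℕ j → toℕ j ≤ toℕ (pos0 σ) → toℕ (σ ⟨$⟩ʳ j) < toℕ (σ ⟨$⟩ʳ i)
decreasing-to-zero σ av {i} {j} i<j j≤z
  with ℕ.<-cmp (toℕ (σ ⟨$⟩ʳ j)) (toℕ (σ ⟨$⟩ʳ i))
... | tri< lt _ _ = lt
... | tri≈ _ eq _ = contradiction (cong toℕ (injective (sym (Fin.toℕ-injective eq)))) (ℕ.<⇒≢ i<j)
  where
  injective : ∀ {x y} → σ ⟨$⟩ʳ x ≡ σ ⟨$⟩ʳ y → x ≡ y
  injective eq = trans (sym (inverseˡ σ)) (trans (cong (σ ⟨$⟩ˡ_) eq) (inverseˡ σ))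
... | tri> _ _ gt = ⊥-elim (av i<j j<z (z<i , gt))
  where
  z = pos0 σ

  σz≡0 : toℕ (σ ⟨$⟩ʳ z) ≡ 0
  σz≡0 = cong toℕ (inverseʳ σ)

  σx≢0 : ∀ {x} → toℕ x < toℕ z → toℕ (σ ⟨$⟩ʳ x) ≢ 0
  σx≢0 {x} x<z eq = ℕ.<⇒≢ x<z (cong toℕ
    (trans (sym (inverseˡ σ)) (cong (σ ⟨$⟩ˡ_) (Fin.toℕ-injective {j = zero} eq))))

  j<z : toℕ j < toℕ z
  j<z = ℕ.≤∧≢⇒< j≤z λ eq → ℕ.n≮0 (subst (toℕ (σ ⟨$⟩ʳ i) <_)
    (trans (cong (toℕ ∘ (σ ⟨$⟩ʳ_)) (Fin.toℕ-injective eq)) σz≡0) gt)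

  z<i : toℕ (σ ⟨$⟩ʳ z) < toℕ (σ ⟨$⟩ʳ i)
  z<i = subst (_< toℕ (σ ⟨$⟩ʳ i)) (sym σz≡0) (ℕ.n≢0⇒n>0 (σx≢0 (ℕ.<-trans i<j j<z)))

decreasingTo-pos0 : ∀ {n} (σ : Permutation′ (suc n)) → Avoids231 σ →
  ∀ p → toℕ p ≤ toℕ (pos0 σ) → DecreasingTo p (toℕ ∘ (σ ⟨$⟩ʳ_))
decreasingTo-pos0 σ av p p≤z =
  decreasingTo p λ i<j j≤p → decreasing-to-zero σ av i<j (ℕ.≤-trans j≤p p≤z)

-- Site z p: p ≤ z + 1, split into the two kinds of insertion place.
data Site {n} (z : Fin n) : Fin (suc n) → Set where
  before : ∀ q → toℕ q ≤ toℕ z → Site z (inject₁ q)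
  after  : Site z (suc z)

site : ∀ {n} (z : Fin n) p → toℕ p ≤ suc (toℕ z) → Site z p
site zero    zero          p≤ = before zero z≤n
site (suc z) zero          p≤ = before zero z≤n
site zero    (suc zero)    p≤ = after
site zero    (suc (suc p)) (s≤s ())
site (suc z) (suc p)       p≤ with site z p (s≤s⁻¹ p≤)
... | before q q≤z = before (suc q) (s≤s q≤z)
... | after        = after

site-bound : ∀ {n} {z : Fin n} {p} → Site z p → toℕ p ≤ suc (toℕ z)
site-bound {z = z} (before q q≤z) =
  subst (_≤ suc (toℕ z)) (sym (Fin.toℕ-inject₁ q)) (ℕ.m≤n⇒m≤1+n q≤z)
site-bound after = ℕ.≤-refl

module _ {n} {p : Fin (suc (suc n))} {σ′ : Permutation′ (suc n)} {σ : Permutation′ (suc (suc n))}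
         (ext : Extends p σ′ σ) where
  open Extends ext

  -- If p = q + 1, then σ decreases up to p, so σ′ decreases up to q, and hence q
  -- cannot lie beyond the minimum of σ′.
  avoids⇒site : Avoids231 σ → Site (pos0 σ′) p
  avoids⇒site av = site (pos0 σ′) p (bound p refl)
    where
    bound : ∀ q → q ≡ p → toℕ q ≤ suc (toℕ (pos0 σ′))
    bound zero    _    = z≤n
    bound (suc q) refl = s≤s (decreasing-before-min q (pos0 σ′) (decreasingTo q dec) (pos0-min σ′))
      where
      dec : ∀ {i j} → toℕ i < toℕ j → toℕ j ≤ toℕ q → toℕ (σ′ ⟨$⟩ʳ j) < toℕ (σ′ ⟨$⟩ʳ i)
      dec {i} {j} i<j j≤q = old-cancel ext j i (decreasing-to-zero σ av
        (punchIn-mono-< p i j i<j)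
        (subst (λ x → toℕ (punchIn p j) ≤ toℕ x) (sym (inverse-new ext))
          (ℕ.<⇒≤ (punchIn-below p j (s≤s j≤q)))))

  -- The new smallest value can only be the last entry of a 231, and then the
  -- first two would be an ascent in the initial decreasing run of σ′.
  extend-avoids : Avoids231 σ′ → Site (pos0 σ′) p → Avoids231 σ
  extend-avoids av s {i} {j} {k} i<j j<k (k<i , i<j′)
    with punchView p i | punchView p j | punchView p k
  ... | self    | _       | _       = new≮ ext k<i
  ... | other i | self    | _       = new≮ ext i<j′
  ... | other i | other j | other k = av (punchIn-cancel-< p i j i<j) (punchIn-cancel-< p j k j<k)
    (old-cancel ext k i k<i , old-cancel ext i j i<j′)
  ... | other i | other j | self    = contradiction
    (decreasing-to-zero σ′ av (punchIn-cancel-< p i j i<j)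
      (s≤s⁻¹ (ℕ.≤-trans (punchIn-below⁻¹ p j j<k) (site-bound s))))
    (ℕ.<-asym (old-cancel ext i j i<j′))

  private
    z = pos0 σ′

    -- The inverse of σ lists p and then the old positions, in the order given by
    -- the inverse of σ′.
    I-bits-tail : descents (λ v → toℕ (σ ⟨$⟩ˡ suc v)) ≡ I-bits σ′
    I-bits-tail = trans (descents-≗ (cong toℕ ∘ inverse-old ext))
      (descents-cong _ _ (λ i j → punchIn-cancel-< p _ _) (λ i j → punchIn-mono-< p _ _))

  -- The smallest value of σ′ stays before the new value, so 1 is an inverse
  -- descent of σ.
  I-bits-after : toℕ z < toℕ p → I-bits σ ≡ true ∷ I-bits σ′
  I-bits-after z<p = cong₂ _∷_ (dec-true (toℕ (σ ⟨$⟩ˡ 1F) <? toℕ (σ ⟨$⟩ˡ 0F)) lt) I-bits-tail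
    where
    lt : toℕ (σ ⟨$⟩ˡ 1F) < toℕ (σ ⟨$⟩ˡ 0F)
    lt rewrite inverse-new ext | inverse-old ext zero = punchIn-below p z z<p

  I-bits-before : toℕ p ≤ toℕ z → I-bits σ ≡ false ∷ I-bits σ′
  I-bits-before p≤z = cong₂ _∷_ (dec-false (toℕ (σ ⟨$⟩ˡ 1F) <? toℕ (σ ⟨$⟩ˡ 0F)) ≮) I-bits-tail
    where
    ≮ : toℕ (σ ⟨$⟩ˡ 1F) < toℕ (σ ⟨$⟩ˡ 0F) → ⊥
    ≮ lt rewrite inverse-new ext | inverse-old ext zero = ℕ.<⇒≱ (punchIn-below⁻¹ p z lt) p≤z

bits-step : ∀ {n p} {σ′ : Permutation′ (suc n)} {σ} → Extends p σ′ σ → Avoids231 σ′ →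
  Site (pos0 σ′) p → Step (I-bits σ′) (D-bits σ′) (I-bits σ) (D-bits σ)
bits-step {σ′ = σ′} {σ} ext av after = subst₂ (Step _ _)
  (sym (I-bits-after ext ℕ.≤-refl))
  (sym (descents-insert-after (pos0 σ′) (decreasingTo-pos0 σ′ av _ ℕ.≤-refl) (pos0-min σ′)
    (insertZero ext)))
  both
bits-step {σ′ = σ′} {σ} ext av (before q q≤z) = subst (λ J → Step (I-bits σ′) (D-bits σ′) J (D-bits σ))
  (sym (I-bits-before ext (subst (_≤ toℕ (pos0 σ′)) (sym (Fin.toℕ-inject₁ q)) q≤z)))
  (pad (descents-insert-before q (decreasingTo-pos0 σ′ av q q≤z) (insertZero ext)))

-- 231-avoiding permutations correspond to admissible pairs

avoids⇒admissible : ∀ {n} (σ : Permutation′ (suc n)) → Avoids231 σ → Admissible n (I-bits σ) (D-bits σ)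
avoids⇒admissible {zero}  σ av = base
avoids⇒admissible {suc n} σ av = step (avoids⇒admissible σ′ av′) (bits-step ext av′ (avoids⇒site ext av))
  where
  σ′  = remove (pos0 σ) σ
  ext = remove-extends σ
  av′ = restrict-avoids ext av

admissible⇒avoids : ∀ {n I D} → Admissible n I D →
  Σ[ σ ∈ Permutation′ (suc n) ] Avoids231 σ × I-bits σ ≡ I × D-bits σ ≡ D
admissible⇒avoids base = id , (λ { {zero} {zero} () }) , refl , refl
admissible⇒avoids (step a s) with σ′ , av , refl , refl ← admissible⇒avoids a = extend s
  where
  extend : ∀ {I⁺ D⁺} → Step (I-bits σ′) (D-bits σ′) I⁺ D⁺ →
    Σ[ σ ∈ Permutation′ _ ] Avoids231 σ × I-bits σ ≡ I⁺ × D-bits σ ≡ D⁺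
  extend both = insert (suc (pos0 σ′)) zero σ′ , extend-avoids ext av after , I-bits-after ext ℕ.≤-refl ,
      descents-insert-after (pos0 σ′) (decreasingTo-pos0 σ′ av _ ℕ.≤-refl) (pos0-min σ′) (insertZero ext)
    where ext = insert-extends (suc (pos0 σ′)) σ′
  extend (pad i) with q , refl , d ← decreasing-from-insertFalse _ i =
      insert (inject₁ q) zero σ′ , extend-avoids ext av (before q q≤z) ,
      I-bits-before ext (subst (_≤ toℕ (pos0 σ′)) (sym (Fin.toℕ-inject₁ q)) q≤z) ,
      insertFalse-functional (descents-insert-before q d (insertZero ext)) i
    where
    ext = insert-extends (inject₁ q) σ′
    q≤z = decreasing-before-min q (pos0 σ′) d (pos0-min σ′)

leadingTrues-D-bits : ∀ {n} (σ : Permutation′ (suc n)) → Avoids231 σ →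
  leadingTrues (D-bits σ) ≡ toℕ (pos0 σ)
leadingTrues-D-bits σ av =
  leadingTrues-descents (pos0 σ) (decreasingTo-pos0 σ av _ ℕ.≤-refl) (pos0-min σ)

extends-unique : ∀ {n p} {σ′ τ′ : Permutation′ n} {σ τ} →
  Extends p σ′ σ → Extends p τ′ τ → σ′ ≈ τ′ → σ ≈ τ
extends-unique {p = p} s t σ′≈τ′ x with punchView p x
... | self    = trans (Extends.new s) (sym (Extends.new t))
... | other i = trans (Extends.old s i) (trans (cong suc (σ′≈τ′ i)) (sym (Extends.old t i)))

bits-injective : ∀ {n} (σ τ : Permutation′ (suc n)) → Avoids231 σ → Avoids231 τ →
  I-bits σ ≡ I-bits τ → D-bits σ ≡ D-bits τ → σ ≈ τ
bits-injective {zero} σ τ avσ avτ I≡ D≡ zero with σ ⟨$⟩ʳ zero | τ ⟨$⟩ʳ zero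
... | zero | zero = refl
bits-injective {suc n} σ τ avσ avτ I≡ D≡ = extends-unique extσ extτ
  (bits-injective (remove (pos0 σ) σ) (remove (pos0 τ) τ) avσ′ avτ′ (proj₁ bits≡) (proj₂ bits≡))
  where
  p≡ : pos0 σ ≡ pos0 τ
  p≡ = Fin.toℕ-injective (trans (sym (leadingTrues-D-bits σ avσ))
    (trans (cong leadingTrues D≡) (leadingTrues-D-bits τ avτ)))

  extσ = remove-extends σ
  extτ : Extends (pos0 σ) (remove (pos0 τ) τ) τ
  extτ = subst (λ p → Extends p (remove (pos0 τ) τ) τ) (sym p≡) (remove-extends τ)
  avσ′ = restrict-avoids extσ avσ
  avτ′ = restrict-avoids extτ avτ

  bits≡ = step-injective
    (bits-step extσ avσ′ (avoids⇒site extσ avσ))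
    (subst₂ (Step _ _) (sym I≡) (sym D≡) (bits-step extτ avτ′ (avoids⇒site extτ avτ)))

-- Φ is a bijection

-- Φ σ is the word read off from the bits of σ, and it is a Dyck path.
reading : ∀ {n} (σ : Permutation′ (suc n)) → Avoids231 σ →
  Zeros (I-bits σ) (D-bits σ) (Φ σ) × Ballot 0 (suc n) (Φ σ)
reading σ av with w , z , b ← admissible⇒ballot (avoids⇒admissible σ av)
  rewrite Φ-unique σ z = z , b

wellDefined : ∀ n → WellDefined (suc n)
wellDefined n σ av = length-Des σ (proj₁ (reading σ av)) , ballot⇒dyck (proj₂ (reading σ av))

Φ-cong : ∀ {n} {σ τ : Permutation′ (suc n)} → σ ≈ τ → Φ σ ≡ Φ τ
Φ-cong {σ = σ} {τ} σ≈τ = begin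
  Φ σ                                               ≡⟨ Φ≡blocks σ ⟩
  blocks (gaps 0 (I-bits σ)) (gaps 0 (D-bits σ))
    ≡⟨ cong₂ (λ I D → blocks (gaps 0 I) (gaps 0 D))
         (descents-≗ (cong toℕ ∘ σ⁻¹≈τ⁻¹)) (descents-≗ (cong toℕ ∘ σ≈τ)) ⟩
  blocks (gaps 0 (I-bits τ)) (gaps 0 (D-bits τ))    ≡⟨ sym (Φ≡blocks τ) ⟩
  Φ τ                                               ∎
  where
  open ≡-Reasoning

  σ⁻¹≈τ⁻¹ : ∀ v → σ ⟨$⟩ˡ v ≡ τ ⟨$⟩ˡ v
  σ⁻¹≈τ⁻¹ v = trans (cong (σ ⟨$⟩ˡ_) (trans (sym (inverseʳ τ)) (sym (σ≈τ (τ ⟨$⟩ˡ v))))) (inverseˡ σ)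

Φ-injective : ∀ {n} (σ τ : Permutation′ (suc n)) → Avoids231 σ → Avoids231 τ → Φ σ ≡ Φ τ → σ ≈ τ
Φ-injective σ τ avσ avτ eq = bits-injective σ τ avσ avτ (proj₁ bits≡) (proj₂ bits≡)
  where
  bits≡ = zeros-injective (subst (Zeros _ _) eq (proj₁ (reading σ avσ))) (proj₁ (reading τ avτ))

Φ-surjective : ∀ {n} {w} → IsDyckPath (suc n) w →
  Σ[ σ ∈ Permutation′ (suc n) ] Avoids231 σ × Φ σ ≡ w
Φ-surjective d with _ , _ , a , z ← ballot⇒admissible (dyck⇒ballot d)
  with σ , av , refl , refl ← admissible⇒avoids a = σ , av , Φ-unique σ z

theorem3p11 : (n : ℕ) → n ≥ 1 →
    Σ[ wd ∈ WellDefined n ] IsBijection _≈S_ _≈D_ (Φ-map wd)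
theorem3p11 zero    ()
theorem3p11 (suc n) _ = wellDefined n , record
  { isInjection = record
    { isCongruent = record
      { cong           = λ {x} {y} → Φ-cong {σ = proj₁ x} {proj₁ y}
      ; isEquivalence₁ = record
        { refl  = λ _ → refl
        ; sym   = λ eq i → sym (eq i)
        ; trans = λ eq eq′ i → trans (eq i) (eq′ i)
        }
      ; isEquivalence₂ = record { refl = refl ; sym = sym ; trans = trans }
      }
    ; injective = λ {x} {y} → Φ-injective (proj₁ x) (proj₁ y) (proj₂ x) (proj₂ y)
    }
  ; surjective = λ (w , d) → let σ , av , eq = Φ-surjective d in
      (σ , av) , λ {τ} τ≈σ → trans (Φ-cong {σ = proj₁ τ} {σ} τ≈σ) eq
  }
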